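{- Let $\mathcal A\subseteq\mathbb N$, $L$ an environment and $T_1,T_2,U$ terms. If $L\vdash_{\mathcal A}T_1:U$ and $L\vdash T_1\to^{*0}T_2$, then $L\vdash_{\mathcal A}T_2:U$.
   Context: Fix a nonempty set $\Sigma$ of sorts with decidable equality, an arbitrary function $\mathrm{next}:\Sigma\to\Sigma$, and a countably infinite set of variables. Terms and environments: $T,U,V,W ::= \star s \mid x \mid \mathrm{app}(V,T) \mid \lambda x{:}W.\,T \mid \mathrm{def}(x{=}V).\,T \mid \mathrm{cast}(U,T)$ ($s\in\Sigma$) and $L,K ::= \emptyset \mid K,x{:}W \mid K,x{=}V$. $\mathrm{app}(V,T)$ applies $T$ to $V$; $\lambda x{:}W.\,T$ (de Bruijn's abstraction) and $\mathrm{def}(x{=}V).\,T$ (local definition) bind $x$ in $T$; $\mathrm{cast}(U,T)$ annotates $T$ with expected type $U$; entries $x{:}W$ and $x{=}V$ bind $x$. Terms are modulo renaming of bound variables. Write $\mathsf{B}x[V]$ for either $\lambda x{:}V$ or $\mathrm{def}(x{=}V)$ and correspondingly $L,x[V]$ for $L,x{:}V$ resp. $L,x{=}V$. One step of bound rt-reduction $L\vdash T_1\to^nT_2$ is the smallest relation closed under: $L\vdash\mathrm{app}(V,\lambda x{:}W.\,T)\to^0\mathrm{def}(x{=}\mathrm{cast}(W,V)).\,T$; $K,x{=}V\vdash x\to^0V$; $L\vdash\mathrm{def}(x{=}V).\,T\to^0T$ if $x$ not free in $T$; $L\vdash\mathrm{app}(V,\mathrm{def}(x{=}W).\,T)\to^0\mathrm{def}(x{=}W).\,\mathrm{app}(V,T)$;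 $L\vdash\mathrm{cast}(U,T)\to^0T$; $L\vdash\star s\to^1\star\,\mathrm{next}(s)$; $K,x{:}W\vdash x\to^1W$; $L\vdash\mathrm{cast}(U,T)\to^1U$; if $K\vdash x\to^nT$, $y\neq x$, $y$ not free in $T$ then $K,y[V]\vdash x\to^nT$; if $L\vdash V_1\to^0V_2$ then $L\vdash\mathrm{app}(V_1,T)\to^0\mathrm{app}(V_2,T)$; if $L\vdash T_1\to^nT_2$ then $L\vdash\mathrm{app}(V,T_1)\to^n\mathrm{app}(V,T_2)$; if $L\vdash V_1\to^0V_2$ then $L\vdash\mathsf Bx[V_1].\,T\to^0\mathsf Bx[V_2].\,T$; if $L,x[V]\vdash T_1\to^nT_2$ then $L\vdash\mathsf Bx[V].\,T_1\to^n\mathsf Bx[V].\,T_2$; if $L\vdash U_1\to^0U_2$ then $L\vdash\mathrm{cast}(U_1,T)\to^0\mathrm{cast}(U_2,T)$; if $L\vdash T_1\to^0T_2$ then $L\vdash\mathrm{cast}(U,T_1)\to^0\mathrm{cast}(U,T_2)$; if $L\vdash U_1\to^1U_2$ and $L\vdash T_1\to^1T_2$ then $L\vdash\mathrm{cast}(U_1,T_1)\to^1\mathrm{cast}(U_2,T_2)$. $L\vdash T_1\to^{*n}T_2$ is the smallest relation with $L\vdash T\to^{*0}T$, containing single steps, and with $L\vdash T_1\to^{*n_1}T$, $L\vdash T\to^{*n_2}T_2$ implying $L\vdash T_1\to^{*n_1+n_2}T_2$. Validity $L\vdash_{\mathcal A}T$ is the smallest predicate closed under: $L\vdash_{\mathcal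 A}\star s$; if $K\vdash_{\mathcal A}V$ then $K,x[V]\vdash_{\mathcal A}x$; if $K\vdash_{\mathcal A}x$ and $y\neq x$ then $K,y[V]\vdash_{\mathcal A}x$; if $L\vdash_{\mathcal A}V$ and $L,x[V]\vdash_{\mathcal A}T$ then $L\vdash_{\mathcal A}\mathsf Bx[V].\,T$; if $L\vdash_{\mathcal A}U$, $L\vdash_{\mathcal A}T$ and some $U_0$ satisfies $L\vdash T\to^{*1}U_0$, $L\vdash U\to^{*0}U_0$, then $L\vdash_{\mathcal A}\mathrm{cast}(U,T)$; if $L\vdash_{\mathcal A}V$, $L\vdash_{\mathcal A}T$ and there are $n\in\mathcal A$, $x,W_0,U_0$ with $L\vdash T\to^{*n}\lambda x{:}W_0.\,U_0$ and $L\vdash V\to^{*1}W_0$, then $L\vdash_{\mathcal A}\mathrm{app}(V,T)$. The type judgment $L\vdash_{\mathcal A}T:U$ means $L\vdash_{\mathcal A}\mathrm{cast}(U,T)$. -}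

module Defs where

open import Data.Nat using (ℕ; zero; suc; _+_; _<ᵇ_)
open import Data.Bool using (if_then_else_)
open import Relation.Unary using (Pred; _∈_)
open import Level using (0ℓ)

-- Terms modulo α-renaming are represented with de Bruijn indices
-- (variable #0 is the innermost binder / last environment entry).

data Binder : Set where
  abst : Binder   -- λx:W.  (de Bruijn's abstraction), entry x:W
  abbr : Binder   -- def(x=V).  (local definition),     entry x=V

data Term (S : Set) : Set where
  sort : S → Term S
  var  : ℕ → Term S
  app  : Term S → Term S → Term S          -- app(V,T): T applied to V
  bind : Binder → Term S → Term S → Term S
  cast : Term S → Term S → Term S

lam : {S : Set} → Term S → Term S → Term S
lam = bind abst

def : {S : Set} → Term S → Term S → Term S
def = bind abbr

data Env (S : Set) : Set where
  ∅   : Env S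
  _,_[_] : Env S → Binder → Term S → Env S

lift : {S : Set} → ℕ → Term S → Term S
lift k (sort s) = sort s
lift k (var i) = if i <ᵇ k then var i else var (suc i)
lift k (app V T) = app (lift k V) (lift k T)
lift k (bind b V T) = bind b (lift k V) (lift (suc k) T)
lift k (cast U T) = cast (lift k U) (lift k T)

↑ : {S : Set} → Term S → Term S
↑ = lift 0

module _ {S : Set} (next : S → S) where

  data Step : Env S → ℕ → Term S → Term S → Set where
    β    : ∀ {L V W T} → Step L 0 (app V (lam W T)) (def (cast W V) T)
    δ    : ∀ {K V} → Step (K , abbr [ V ]) 0 (var 0) (↑ V)
    ζ    : ∀ {L V T} → Step L 0 (def V (↑ T)) T
    θ    : ∀ {L V W T} → Step L 0 (app V (def W T)) (def W (app (↑ V) T))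
    ε    : ∀ {L U T} → Step L 0 (cast U T) T
    srt  : ∀ {L s} → Step L 1 (sort s) (sort (next s))
    ldec : ∀ {K W} → Step (K , abst [ W ]) 1 (var 0) (↑ W)
    ee   : ∀ {L U T} → Step L 1 (cast U T) U
    lref : ∀ {K b V i n T} → Step K n (var i) T →
           Step (K , b [ V ]) n (var (suc i)) (↑ T)
    appV : ∀ {L V₁ V₂ T} → Step L 0 V₁ V₂ → Step L 0 (app V₁ T) (app V₂ T)
    appT : ∀ {L V n T₁ T₂} → Step L n T₁ T₂ → Step L n (app V T₁) (app V T₂)
    bndV : ∀ {L b V₁ V₂ T} → Step L 0 V₁ V₂ → Step L 0 (bind b V₁ T) (bind b V₂ T)
    bndT : ∀ {L b V n T₁ T₂} → Step (L , b [ V ]) n T₁ T₂ →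
           Step L n (bind b V T₁) (bind b V T₂)
    cstU : ∀ {L U₁ U₂ T} → Step L 0 U₁ U₂ → Step L 0 (cast U₁ T) (cast U₂ T)
    cstT : ∀ {L U T₁ T₂} → Step L 0 T₁ T₂ → Step L 0 (cast U T₁) (cast U T₂)
    cst1 : ∀ {L U₁ U₂ T₁ T₂} → Step L 1 U₁ U₂ → Step L 1 T₁ T₂ →
           Step L 1 (cast U₁ T₁) (cast U₂ T₂)

  data Steps : Env S → ℕ → Term S → Term S → Set where
    s-refl  : ∀ {L T} → Steps L 0 T T
    s-step  : ∀ {L n T₁ T₂} → Step L n T₁ T₂ → Steps L n T₁ T₂
    s-trans : ∀ {L n₁ n₂ T₁ T T₂} → Steps L n₁ T₁ T → Steps L n₂ T T₂ →
              Steps L (n₁ + n₂) T₁ T₂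

  data Valid (A : Pred ℕ 0ℓ) : Env S → Term S → Set where
    v-sort : ∀ {L s} → Valid A L (sort s)
    v-zero : ∀ {K b V} → Valid A K V → Valid A (K , b [ V ]) (var 0)
    v-suc  : ∀ {K b V i} → Valid A K (var i) → Valid A (K , b [ V ]) (var (suc i))
    v-bind : ∀ {L b V T} → Valid A L V → Valid A (L , b [ V ]) T →
             Valid A L (bind b V T)
    v-cast : ∀ {L U T U₀} → Valid A L U → Valid A L T →
             Steps L 1 T U₀ → Steps L 0 U U₀ → Valid A L (cast U T)
    v-app  : ∀ {L V T n W₀ U₀} → Valid A L V → Valid A L T →
             n ∈ A → Steps L n T (lam W₀ U₀) → Steps L 1 V W₀ →
             Valid A L (app V T)

  Typed : Pred ℕ 0ℓ → Env S → Term S → Term S → Set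
  Typed A L T U = Valid A L (cast U T)

-- The n-th iterated type of a term is computed by recursion on the term (ty): a declared variable x:W
-- yields W at level 1, cast(U,T) yields T at level 0 and U above, and definitions are unfolded.
-- The values are terms compared up to plain β-conversion, which is confluent without any validity
-- hypothesis, and a λ is annotated with the iterated types of its domain at all levels 0..N, so that
-- convertible λ's have domains convertible at all these levels.  Validity is rephrased (Ok) by requiring
-- the side conditions of casts and applications at all levels available: the types of T are those of U
-- one level up, resp. the types of V one level up are those of the domain.  These conditions are
-- preserved by every rt-step by inspection, and the cast in β is what makes the types of the
-- substituted variable agree on both sides.  Valid terms are Ok for N large enough; conversely T
-- reaches its n-th iterated type by n-bounded reduction, so Ok terms are valid.  No normalization
-- argument is needed.

module Submission where

open import Defs
open import Data.Nat using (ℕ; zero; suc; _+_; _∸_; _⊔_; _≤_; _<_; z≤n; s≤s; _<ᵇ_)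
open import Data.Nat.Properties
open import Data.Bool using (true; false; if_then_else_)
open import Data.Empty using (⊥)
open import Data.Unit using (⊤; tt)
open import Data.Sum using (inj₁; inj₂)
open import Data.Product using (∃; ∃₂; _×_; _,_; proj₁; proj₂)
open import Function using (_∘_; id)
open import Relation.Unary using (Pred; _∈_)
open import Relation.Binary.Definitions using (DecidableEquality)
open import Relation.Binary.PropositionalEquality using (_≡_; refl; sym; trans; cong; cong₂; subst)
open import Relation.Binary.Construct.Closure.ReflexiveTransitive using (Star; _◅_; _◅◅_; gmap) renaming (ε to done)
open import Level using (0ℓ)

private variable
  S : Set
  f g : ℕ → ℕ
  b : Binder

-- Renamings and parallel substitutions.

ext : (ℕ → ℕ) → ℕ → ℕ
ext f zero    = zero
ext f (suc i) = suc (f i)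

ren : (ℕ → ℕ) → Term S → Term S
ren f (sort s)     = sort s
ren f (var i)      = var (f i)
ren f (app V T)    = app (ren f V) (ren f T)
ren f (bind b V T) = bind b (ren f V) (ren (ext f) T)
ren f (cast U T)   = cast (ren f U) (ren f T)

exts : (ℕ → Term S) → ℕ → Term S
exts σ zero    = var 0
exts σ (suc i) = ren suc (σ i)

sub : (ℕ → Term S) → Term S → Term S
sub σ (sort s)     = sort s
sub σ (var i)      = σ i
sub σ (app V T)    = app (sub σ V) (sub σ T)
sub σ (bind b V T) = bind b (sub σ V) (sub (exts σ) T)
sub σ (cast U T)   = cast (sub σ U) (sub σ T)

inst : Term S → ℕ → Term S
inst V zero    = V
inst V (suc i) = var i

ext-cong : (∀ i → f i ≡ g i) → ∀ i → ext f i ≡ ext g i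
ext-cong e zero    = refl
ext-cong e (suc i) = cong suc (e i)

ren-cong : (∀ i → f i ≡ g i) → (t : Term S) → ren f t ≡ ren g t
ren-cong e (sort s)     = refl
ren-cong e (var i)      = cong var (e i)
ren-cong e (app V T)    = cong₂ app (ren-cong e V) (ren-cong e T)
ren-cong e (bind b V T) = cong₂ (bind b) (ren-cong e V) (ren-cong (ext-cong e) T)
ren-cong e (cast U T)   = cong₂ cast (ren-cong e U) (ren-cong e T)

ext-∘ : ∀ i → ext f (ext g i) ≡ ext (f ∘ g) i
ext-∘ zero    = refl
ext-∘ (suc i) = refl

ren-ren : (t : Term S) → ren f (ren g t) ≡ ren (f ∘ g) t
ren-ren (sort s)     = refl
ren-ren (var i)      = refl
ren-ren (app V T)    = cong₂ app (ren-ren V) (ren-ren T)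
ren-ren (bind b V T) = cong₂ (bind b) (ren-ren V) (trans (ren-ren T) (ren-cong ext-∘ T))
ren-ren (cast U T)   = cong₂ cast (ren-ren U) (ren-ren T)

ren-ext-suc : (t : Term S) → ren (ext f) (ren suc t) ≡ ren suc (ren f t)
ren-ext-suc t = trans (ren-ren t) (sym (ren-ren t))

ext-id : ∀ i → ext id i ≡ i
ext-id zero    = refl
ext-id (suc i) = refl

ren-id : (t : Term S) → ren id t ≡ t
ren-id (sort s)     = refl
ren-id (var i)      = refl
ren-id (app V T)    = cong₂ app (ren-id V) (ren-id T)
ren-id (bind b V T) = cong₂ (bind b) (ren-id V) (trans (ren-cong ext-id T) (ren-id T))
ren-id (cast U T)   = cong₂ cast (ren-id U) (ren-id T)

exts-cong : {σ τ : ℕ → Term S} → (∀ i → σ i ≡ τ i) → ∀ i → exts σ i ≡ exts τ i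
exts-cong e zero    = refl
exts-cong e (suc i) = cong (ren suc) (e i)

sub-cong : {σ τ : ℕ → Term S} → (∀ i → σ i ≡ τ i) → ∀ t → sub σ t ≡ sub τ t
sub-cong e (sort s)     = refl
sub-cong e (var i)      = e i
sub-cong e (app V T)    = cong₂ app (sub-cong e V) (sub-cong e T)
sub-cong e (bind b V T) = cong₂ (bind b) (sub-cong e V) (sub-cong (exts-cong e) T)
sub-cong e (cast U T)   = cong₂ cast (sub-cong e U) (sub-cong e T)

ren-as-sub : (t : Term S) → sub (var ∘ f) t ≡ ren f t
ren-as-sub (sort s)     = refl
ren-as-sub (var i)      = refl
ren-as-sub (app V T)    = cong₂ app (ren-as-sub V) (ren-as-sub T)
ren-as-sub (bind b V T) =
  cong₂ (bind b) (ren-as-sub V)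
    (trans (sub-cong (λ { zero → refl ; (suc i) → refl }) T) (ren-as-sub T))
ren-as-sub (cast U T)   = cong₂ cast (ren-as-sub U) (ren-as-sub T)

sub-var : (t : Term S) → sub var t ≡ t
sub-var t = trans (ren-as-sub t) (ren-id t)

sub-ren : {σ : ℕ → Term S} (t : Term S) → sub σ (ren f t) ≡ sub (σ ∘ f) t
sub-ren (sort s)     = refl
sub-ren (var i)      = refl
sub-ren (app V T)    = cong₂ app (sub-ren V) (sub-ren T)
sub-ren (bind b V T) =
  cong₂ (bind b) (sub-ren V)
    (trans (sub-ren T) (sub-cong (λ { zero → refl ; (suc i) → refl }) T))
sub-ren (cast U T)   = cong₂ cast (sub-ren U) (sub-ren T)

ren-sub : {σ : ℕ → Term S} (t : Term S) → ren f (sub σ t) ≡ sub (ren f ∘ σ) t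
ren-sub (sort s)     = refl
ren-sub (var i)      = refl
ren-sub (app V T)    = cong₂ app (ren-sub V) (ren-sub T)
ren-sub {σ = σ} (bind b V T) =
  cong₂ (bind b) (ren-sub V)
    (trans (ren-sub T) (sub-cong (λ { zero → refl ; (suc i) → ren-ext-suc (σ i) }) T))
ren-sub (cast U T)   = cong₂ cast (ren-sub U) (ren-sub T)

sub-exts-suc : {σ : ℕ → Term S} (t : Term S) → sub (exts σ) (ren suc t) ≡ ren suc (sub σ t)
sub-exts-suc t = trans (sub-ren t) (sym (ren-sub t))

sub-sub : {σ τ : ℕ → Term S} (t : Term S) → sub σ (sub τ t) ≡ sub (sub σ ∘ τ) t
sub-sub (sort s)     = refl
sub-sub (var i)      = refl
sub-sub (app V T)    = cong₂ app (sub-sub V) (sub-sub T)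
sub-sub {τ = τ} (bind b V T) =
  cong₂ (bind b) (sub-sub V)
    (trans (sub-sub T) (sub-cong (λ { zero → refl ; (suc i) → sub-exts-suc (τ i) }) T))
sub-sub (cast U T)   = cong₂ cast (sub-sub U) (sub-sub T)

inst-suc : {V : Term S} (t : Term S) → sub (inst V) (ren suc t) ≡ t
inst-suc t = trans (sub-ren t) (sub-var t)

sub-inst : {σ : ℕ → Term S} {V : Term S} (t : Term S) →
  sub (inst (sub σ V)) (sub (exts σ) t) ≡ sub σ (sub (inst V) t)
sub-inst {σ = σ} t = trans (sub-sub t) (trans
  (sub-cong (λ { zero → refl ; (suc i) → inst-suc (σ i) }) t)
  (sym (sub-sub t)))

lift-ren : ∀ k (t : Term S) → lift k t ≡ ren (λ i → if i <ᵇ k then i else suc i) t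
lift-ren k (sort s)     = refl
lift-ren k (var i) with i <ᵇ k
... | true  = refl
... | false = refl
lift-ren k (app V T)    = cong₂ app (lift-ren k V) (lift-ren k T)
lift-ren k (bind b V T) =
  cong₂ (bind b) (lift-ren k V) (trans (lift-ren (suc k) T) (ren-cong pointwise T))
  where
  pointwise : ∀ i → (if i <ᵇ suc k then i else suc i)
                  ≡ ext (λ i → if i <ᵇ k then i else suc i) i
  pointwise zero = refl
  pointwise (suc i) with i <ᵇ k
  ... | true  = refl
  ... | false = refl
lift-ren k (cast U T)   = cong₂ cast (lift-ren k U) (lift-ren k T)

↑-ren : (t : Term S) → ↑ t ≡ ren suc t
↑-ren t = lift-ren 0 t

-- Plain β-reduction, with casts and definitions inert

infix 4 _⇒_ _⇒*_ _≈_

data _⇒_ {S : Set} : Term S → Term S → Set where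
  p-sort : ∀ {s} → sort s ⇒ sort s
  p-var  : ∀ {i} → var i ⇒ var i
  p-app  : ∀ {V V′ T T′} → V ⇒ V′ → T ⇒ T′ → app V T ⇒ app V′ T′
  p-bind : ∀ {b V V′ T T′} → V ⇒ V′ → T ⇒ T′ → bind b V T ⇒ bind b V′ T′
  p-cast : ∀ {U U′ T T′} → U ⇒ U′ → T ⇒ T′ → cast U T ⇒ cast U′ T′
  p-β    : ∀ {V V′ W T T′} → V ⇒ V′ → T ⇒ T′ → app V (lam W T) ⇒ sub (inst V′) T′

p-refl : (t : Term S) → t ⇒ t
p-refl (sort s)     = p-sort
p-refl (var i)      = p-var
p-refl (app V T)    = p-app (p-refl V) (p-refl T)
p-refl (bind b V T) = p-bind (p-refl V) (p-refl T)
p-refl (cast U T)   = p-cast (p-refl U) (p-refl T)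

p-ren : {t u : Term S} → t ⇒ u → ren f t ⇒ ren f u
p-ren p-sort       = p-sort
p-ren p-var        = p-var
p-ren (p-app p q)  = p-app (p-ren p) (p-ren q)
p-ren (p-bind p q) = p-bind (p-ren p) (p-ren q)
p-ren (p-cast p q) = p-cast (p-ren p) (p-ren q)
p-ren {f = f} (p-β {V′ = V′} {T′ = T′} p q) =
  subst (app _ _ ⇒_) ren-inst (p-β (p-ren p) (p-ren q))
  where
  ren-inst : sub (inst (ren f V′)) (ren (ext f) T′) ≡ ren f (sub (inst V′) T′)
  ren-inst = trans (sub-ren T′) (trans
    (sub-cong (λ { zero → refl ; (suc i) → refl }) T′) (sym (ren-sub T′)))

p-exts : {σ τ : ℕ → Term S} → (∀ i → σ i ⇒ τ i) → ∀ i → exts σ i ⇒ exts τ i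
p-exts h zero    = p-var
p-exts h (suc i) = p-ren (h i)

p-sub : {σ τ : ℕ → Term S} → (∀ i → σ i ⇒ τ i) → ∀ {t u} → t ⇒ u → sub σ t ⇒ sub τ u
p-sub h p-sort         = p-sort
p-sub h (p-var {i})    = h i
p-sub h (p-app p q)    = p-app (p-sub h p) (p-sub h q)
p-sub h (p-bind p q)   = p-bind (p-sub h p) (p-sub (p-exts h) q)
p-sub h (p-cast p q)   = p-cast (p-sub h p) (p-sub h q)
p-sub h (p-β {T′ = T′} p q) =
  subst (app _ _ ⇒_) (sub-inst T′) (p-β (p-sub h p) (p-sub (p-exts h) q))

p-inst : {V V′ T T′ : Term S} → V ⇒ V′ → T ⇒ T′ → sub (inst V) T ⇒ sub (inst V′) T′
p-inst p q = p-sub (λ { zero → p ; (suc i) → p-var }) q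

-- Takahashi's complete development, which contracts all redexes of the term at once.
develop : Term S → Term S
develop (sort s)               = sort s
develop (var i)                = var i
develop (app V (bind abst W T)) = sub (inst (develop V)) (develop T)
develop (app V T)              = app (develop V) (develop T)
develop (bind b V T)           = bind b (develop V) (develop T)
develop (cast U T)             = cast (develop U) (develop T)

-- Whatever redexes of `t` the step left alone can still be contracted in one parallel step. The
-- split on `T` follows `develop`; an uncontracted redex is the case `bind abst`.
triangle : {t u : Term S} → t ⇒ u → u ⇒ develop t
triangle p-sort       = p-sort
triangle p-var        = p-var
triangle (p-app {T = sort _} p q)        = p-app (triangle p) (triangle q)
triangle (p-app {T = var _} p q)         = p-app (triangle p) (triangle q)
triangle (p-app {T = app _ _} p q)       = p-app (triangle p) (triangle q)
triangle (p-app {T = bind abst _ _} p (p-bind q r)) = p-β (triangle p) (triangle r)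
triangle (p-app {T = bind abbr _ _} p q) = p-app (triangle p) (triangle q)
triangle (p-app {T = cast _ _} p q)      = p-app (triangle p) (triangle q)
triangle (p-bind p q) = p-bind (triangle p) (triangle q)
triangle (p-cast p q) = p-cast (triangle p) (triangle q)
triangle (p-β p q)    = p-inst (triangle p) (triangle q)

_⇒*_ : Term S → Term S → Set
_⇒*_ = Star _⇒_

strip-lemma : {t u v : Term S} → t ⇒ u → t ⇒* v → ∃ λ w → u ⇒* w × v ⇒ w
strip-lemma p done    = _ , done , p
strip-lemma p (q ◅ r) =
  let w , s , l = strip-lemma (triangle q) r in w , triangle p ◅ s , l

confluent : {t u v : Term S} → t ⇒* u → t ⇒* v → ∃ λ w → u ⇒* w × v ⇒* w
confluent done    q = _ , q , done
confluent (p ◅ r) q =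
  let w , s , l = strip-lemma p q
      x , a , c = confluent r s
  in x , a , l ◅ c

-- Convertible terms come with a common reduct, which later supplies the witnesses of validity.
-- Confluence enters through transitivity.
_≈_ : Term S → Term S → Set
t ≈ u = ∃ λ v → t ⇒* v × u ⇒* v

≈-refl : {t : Term S} → t ≈ t
≈-refl = _ , done , done

≈-reflexive : {t u : Term S} → t ≡ u → t ≈ u
≈-reflexive refl = ≈-refl

≈-sym : {t u : Term S} → t ≈ u → u ≈ t
≈-sym (v , p , q) = v , q , p

≈-trans : {t u v : Term S} → t ≈ u → u ≈ v → t ≈ v
≈-trans (_ , p , q) (_ , r , s) =
  let w , a , c = confluent q r in w , p ◅◅ a , s ◅◅ c

≈-map : (F : Term S → Term S) → (∀ {t u} → t ⇒ u → F t ⇒ F u) →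
  ∀ {t u} → t ≈ u → F t ≈ F u
≈-map F h (v , p , q) = F v , gmap F h p , gmap F h q

≈-cong₂ : (F : Term S → Term S → Term S) →
  (∀ {t t′ u u′} → t ⇒ t′ → u ⇒ u′ → F t u ⇒ F t′ u′) →
  ∀ {t t′ u u′} → t ≈ t′ → u ≈ u′ → F t u ≈ F t′ u′
≈-cong₂ F h {t} {t′} {u} {u′} p q =
  ≈-trans (≈-map (λ x → F x u) (λ r → h r (p-refl u)) p) (≈-map (F t′) (h (p-refl t′)) q)

≈-sub : {σ : ℕ → Term S} → ∀ {t u} → t ≈ u → sub σ t ≈ sub σ u
≈-sub = ≈-map _ (p-sub (λ i → p-refl _))

≈-ren : ∀ {t u : Term S} → t ≈ u → ren f t ≈ ren f u
≈-ren = ≈-map _ p-ren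

≈-app : {V V′ T T′ : Term S} → V ≈ V′ → T ≈ T′ → app V T ≈ app V′ T′
≈-app = ≈-cong₂ app p-app

≈-bind : {V V′ T T′ : Term S} → V ≈ V′ → T ≈ T′ → bind b V T ≈ bind b V′ T′
≈-bind {b = b} = ≈-cong₂ (bind b) p-bind

≈-cast : {V V′ T T′ : Term S} → V ≈ V′ → T ≈ T′ → cast V T ≈ cast V′ T′
≈-cast = ≈-cong₂ cast p-cast

≈-β : {V W T : Term S} → app V (lam W T) ≈ sub (inst V) T
≈-β = _ , p-β (p-refl _) (p-refl _) ◅ done , done

-- The head of a redex is always an `app`, so a `bind` persists and its components reduce
-- separately. The same goes for `cast`.
bind-⇒* : {V T t : Term S} → bind b V T ⇒* t →
  ∃₂ λ V′ T′ → t ≡ bind b V′ T′ × V ⇒* V′ × T ⇒* T′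
bind-⇒* done = _ , _ , refl , done , done
bind-⇒* (p-bind p q ◅ r) =
  let _ , _ , e , s , u = bind-⇒* r in _ , _ , e , p ◅ s , q ◅ u

bind-injˡ : {V V′ T T′ : Term S} → bind b V T ≈ bind b V′ T′ → V ≈ V′
bind-injˡ (_ , p , q) with bind-⇒* p | bind-⇒* q
... | _ , _ , refl , r , _ | _ , _ , refl , s , _ = _ , r , s

cast-⇒* : {U T t : Term S} → cast U T ⇒* t →
  ∃₂ λ U′ T′ → t ≡ cast U′ T′ × U ⇒* U′ × T ⇒* T′
cast-⇒* done = _ , _ , refl , done , done
cast-⇒* (p-cast p q ◅ r) =
  let _ , _ , e , s , u = cast-⇒* r in _ , _ , e , p ◅ s , q ◅ u

cast-inj : {U U′ T T′ : Term S} → cast U T ≈ cast U′ T′ → U ≈ U′ × T ≈ T′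
cast-inj (_ , p , q) with cast-⇒* p | cast-⇒* q
... | _ , _ , refl , r , r′ | _ , _ , refl , s , s′ = (_ , r , s) , (_ , r′ , s′)

-- Tuples of terms, coded with the inert casts

chain : (ℕ → Term S) → ℕ → Term S
chain w zero    = w 0
chain w (suc N) = cast (w (suc N)) (chain w N)

sub-chain : {σ : ℕ → Term S} (w : ℕ → Term S) → ∀ N → sub σ (chain w N) ≡ chain (sub σ ∘ w) N
sub-chain w zero    = refl
sub-chain w (suc N) = cong (cast _) (sub-chain w N)

≈-chain : {w w′ : ℕ → Term S} → ∀ N → (∀ k → k ≤ N → w k ≈ w′ k) → chain w N ≈ chain w′ N
≈-chain zero    h = h 0 z≤n
≈-chain (suc N) h = ≈-cast (h (suc N) ≤-refl) (≈-chain N (λ k k≤N → h k (m≤n⇒m≤1+n k≤N)))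

chain-inj : {w w′ : ℕ → Term S} → ∀ N → chain w N ≈ chain w′ N → ∀ k → k < suc N → w k ≈ w′ k
chain-inj zero    e zero k< = e
chain-inj zero    e (suc k) (s≤s ())
chain-inj (suc N) e k k< with m<1+n⇒m<n∨m≡n k<
... | inj₁ k<N = chain-inj N (proj₂ (cast-inj e)) k k<N
... | inj₂ refl = proj₁ (cast-inj e)

-- Renaming in bound rt-reduction, and simulation of plain β-reduction.

↑-ext : (t : Term S) → ↑ (ren f t) ≡ ren (ext f) (↑ t)
↑-ext t = trans (↑-ren _) (trans (sym (ren-ext-suc t)) (cong (ren _) (sym (↑-ren t))))

module _ {S : Set} {next : S → S} where

  -- A step consults the environment only at variables, so compatibility with a renaming is asked of
  -- variables alone.
  RenamesVars : (ℕ → ℕ) → Env S → Env S → Set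
  RenamesVars f L L′ = ∀ {n i T} → Step next L n (var i) T → Step next L′ n (var (f i)) (ren f T)

  renamesVars-ext : ∀ {L L′ V} → RenamesVars f L L′ →
    RenamesVars (ext f) (L , b [ V ]) (L′ , b [ ren f V ])
  renamesVars-ext h (δ {V = V})        = subst (Step next _ 0 (var 0)) (↑-ext V) δ
  renamesVars-ext h (ldec {W = W})     = subst (Step next _ 1 (var 0)) (↑-ext W) ldec
  renamesVars-ext h (lref {T = T} s) = subst (Step next _ _ _) (↑-ext T) (lref (h s))

  step-ren : ∀ {L L′ n T X} → RenamesVars f L L′ → Step next L n T X →
    Step next L′ n (ren f T) (ren f X)
  step-ren h β          = β
  step-ren h s@δ        = h s
  step-ren {f = f} h (ζ {T = T}) =
    subst (λ t → Step next _ 0 (def _ t) (ren f T)) (↑-ext T) ζ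
  step-ren {f = f} h (θ {V = V} {W} {T}) =
    subst (λ t → Step next _ 0 (app (ren f V) (def (ren f W) _)) (def (ren f W) (app t _)))
          (↑-ext V) θ
  step-ren h ε          = ε
  step-ren h srt        = srt
  step-ren h s@ldec     = h s
  step-ren h ee         = ee
  step-ren h s@(lref _) = h s
  step-ren h (appV s)   = appV (step-ren h s)
  step-ren h (appT s)   = appT (step-ren h s)
  step-ren h (bndV s)   = bndV (step-ren h s)
  step-ren h (bndT s)   = bndT (step-ren (renamesVars-ext h) s)
  step-ren h (cstU s)   = cstU (step-ren h s)
  step-ren h (cstT s)   = cstT (step-ren h s)
  step-ren h (cst1 s t) = cst1 (step-ren h s) (step-ren h t)

  steps-map : ∀ {L L′} (F : Term S → Term S) →
    (∀ {n t u} → Step next L n t u → Step next L′ n (F t) (F u)) →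
    ∀ {n t u} → Steps next L n t u → Steps next L′ n (F t) (F u)
  steps-map F h s-refl        = s-refl
  steps-map F h (s-step s)    = s-step (h s)
  steps-map F h (s-trans r s) = s-trans (steps-map F h r) (steps-map F h s)

  -- The level is a variable with a proof of `n ≡ 0`, because the index `n₁ + n₂` of `s-trans` does
  -- not unify with `0`.
  steps₀-map : ∀ {L L′} (F : Term S → Term S) →
    (∀ {t u} → Step next L 0 t u → Step next L′ 0 (F t) (F u)) →
    ∀ {n t u} → n ≡ 0 → Steps next L n t u → Steps next L′ n (F t) (F u)
  steps₀-map F h e s-refl        = s-refl
  steps₀-map F h refl (s-step s) = s-step (h s)
  steps₀-map F h e (s-trans {n₁ = n₁} {n₂} r s) =
    s-trans (steps₀-map F h (m+n≡0⇒m≡0 n₁ e) r) (steps₀-map F h (m+n≡0⇒n≡0 n₁ e) s)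

  steps-weaken : ∀ {L V n T X} → Steps next L n T X →
    Steps next (L , b [ V ]) n (ren suc T) (ren suc X)
  steps-weaken = steps-map (ren suc)
    (step-ren (λ {_} {_} {T} s → subst (Step next _ _ _) (↑-ren T) (lref s)))

  steps-app : ∀ {L V V′ n T T′} → Steps next L 0 V V′ → Steps next L n T T′ →
    Steps next L n (app V T) (app V′ T′)
  steps-app r s =
    s-trans (steps₀-map (λ V → app V _) appV refl r) (steps-map (app _) appT s)

  steps-bind : ∀ {L V V′ n T T′} → Steps next L 0 V V′ → Steps next (L , b [ V ]) n T T′ →
    Steps next L n (bind b V T) (bind b V′ T′)
  steps-bind {b = b} {n = n} r s = subst (λ k → Steps next _ k _ _) (+-identityʳ n)
    (s-trans (steps-map (bind b _) bndT s) (steps₀-map (λ V → bind b V _) bndV refl r))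

  steps-cast : ∀ {L U U′ T T′} → Steps next L 0 U U′ → Steps next L 0 T T′ →
    Steps next L 0 (cast U T) (cast U′ T′)
  steps-cast r s =
    s-trans (steps₀-map (λ U → cast U _) cstU refl r) (steps₀-map (cast _) cstT refl s)

  steps-ζ : ∀ {L V n T X} → Steps next (L , abbr [ V ]) n T (ren suc X) →
    Steps next L n (def V T) X
  steps-ζ {n = n} {X = X} s = subst (λ k → Steps next _ k _ _) (+-identityʳ n)
    (s-trans (steps-map (def _) bndT s)
             (s-step (subst (λ t → Step next _ 0 (def _ t) X) (↑-ren X) ζ)))

  steps-δ : ∀ {L V n X} → Steps next L n V X →
    Steps next (L , abbr [ V ]) n (var 0) (ren suc X)
  steps-δ {V = V} s =
    s-trans (s-step (subst (Step next _ 0 (var 0)) (↑-ren V) δ)) (steps-weaken s)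

  steps-ldec : ∀ {L W n X} → Steps next L n W X →
    Steps next (L , abst [ W ]) (suc n) (var 0) (ren suc X)
  steps-ldec {W = W} s =
    s-trans (s-step (subst (Step next _ 1 (var 0)) (↑-ren W) ldec)) (steps-weaken s)

  -- Unfolds all occurrences of variables: `σ` gives their values and `f` carries these back into
  -- the environment of `T`. It is applied with `f = suc`, the values living outside the definition
  -- being unfolded.
  steps-unfold : ∀ {L} {σ : ℕ → Term S} →
    (∀ i → Steps next L 0 (var i) (ren f (σ i))) → ∀ T → Steps next L 0 T (ren f (sub σ T))
  steps-unfold h (sort s)     = s-refl
  steps-unfold h (var i)      = h i
  steps-unfold h (app V T)    = steps-app (steps-unfold h V) (steps-unfold h T)
  steps-unfold {f = f} {σ = σ} h (bind b V T) =
    s-trans (steps-bind (steps-unfold h V) s-refl)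
            (steps-bind s-refl (steps-unfold h′ T))
    where
    h′ : ∀ i → Steps next (_ , b [ _ ]) 0 (var i) (ren (ext f) (exts σ i))
    h′ zero    = s-refl
    h′ (suc i) = subst (Steps next _ 0 _) (sym (ren-ext-suc (σ i))) (steps-weaken (h i))
  steps-unfold h (cast U T)   = steps-cast (steps-unfold h U) (steps-unfold h T)

  -- A β-redex becomes a definition; `δ` unfolds each occurrence of its variable to `cast W V′`, `ε`
  -- drops the annotation, and `ζ` finally discards the definition.
  par⇒steps : ∀ {L T X} → T ⇒ X → Steps next L 0 T X
  par⇒steps p-sort       = s-refl
  par⇒steps p-var        = s-refl
  par⇒steps (p-app p q)  = steps-app (par⇒steps p) (par⇒steps q)
  par⇒steps (p-bind p q) = steps-bind (par⇒steps p) (par⇒steps q)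
  par⇒steps (p-cast p q) = steps-cast (par⇒steps p) (par⇒steps q)
  par⇒steps (p-β {V′ = V′} {W} {T′ = T′} p q) =
    s-trans (steps-app (par⇒steps p) (steps-bind s-refl (par⇒steps q)))
      (s-trans (s-step β) (steps-ζ (steps-unfold unfold₀ T′)))
    where
    unfold₀ : ∀ i → Steps next (_ , abbr [ cast W V′ ]) 0 (var i) (ren suc (inst V′ i))
    unfold₀ zero    = steps-δ (s-step ε)
    unfold₀ (suc i) = s-refl

  par*⇒steps : ∀ {L T X} → T ⇒* X → Steps next L 0 T X
  par*⇒steps done    = s-refl
  par*⇒steps (p ◅ r) = s-trans (par⇒steps p) (par*⇒steps r)

-- Iterated types

-- Turns an iterated type into a term that reduction can reach. The casts in iterated types only
-- code the tuples annotating a λ, and of such a tuple the component `w 0` is kept.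
strip : Term S → Term S
strip (sort s)     = sort s
strip (var i)      = var i
strip (app V T)    = app (strip V) (strip T)
strip (bind b V T) = bind b (strip V) (strip T)
strip (cast U T)   = strip T

strip-ren : (t : Term S) → strip (ren f t) ≡ ren f (strip t)
strip-ren (sort s)     = refl
strip-ren (var i)      = refl
strip-ren (app V T)    = cong₂ app (strip-ren V) (strip-ren T)
strip-ren (bind b V T) = cong₂ (bind b) (strip-ren V) (strip-ren T)
strip-ren (cast U T)   = strip-ren T

strip-sub : {σ : ℕ → Term S} (t : Term S) → strip (sub σ t) ≡ sub (strip ∘ σ) (strip t)
strip-sub (sort s)     = refl
strip-sub (var i)      = refl
strip-sub (app V T)    = cong₂ app (strip-sub V) (strip-sub T)
strip-sub {σ = σ} (bind b V T) =
  cong₂ (bind b) (strip-sub V)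
    (trans (strip-sub T) (sub-cong (λ { zero → refl ; (suc i) → strip-ren (σ i) }) (strip T)))
strip-sub (cast U T)   = strip-sub T

p-strip : {t u : Term S} → t ⇒ u → strip t ⇒ strip u
p-strip p-sort       = p-sort
p-strip p-var        = p-var
p-strip (p-app p q)  = p-app (p-strip p) (p-strip q)
p-strip (p-bind p q) = p-bind (p-strip p) (p-strip q)
p-strip (p-cast p q) = p-strip q
p-strip (p-β {T′ = T′} p q) =
  subst (app _ _ ⇒_)
    (sym (trans (strip-sub T′) (sub-cong (λ { zero → refl ; (suc i) → refl }) (strip T′))))
    (p-β (p-strip p) (p-strip q))

strip-chain : (w : ℕ → Term S) → ∀ N → strip (chain w N) ≡ strip (w 0)
strip-chain w zero    = refl
strip-chain w (suc N) = strip-chain w N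

Types : Set → Set
Types S = ℕ → Term S

-- Values range over declared variables only, so crossing an `abbr` entry shifts nothing; `liftD`,
-- `extS` and `shiftS` follow the same rule.
extD : Binder → Types S → (ℕ → Types S) → ℕ → Types S
extD abst w ρ zero    zero    = var 0
extD abst w ρ zero    (suc n) = ren suc (w n)
extD abst w ρ (suc i) n       = ren suc (ρ i n)
extD abbr v ρ zero    n       = v n
extD abbr v ρ (suc i) n       = ρ i n

-- The new variable gets `⊤` because `o-bind` records the condition on `V` separately; `ok-enter`
-- and `ok-leave` pass between this form and `Φ`.
extP : (ℕ → Set) → ℕ → Set
extP P zero    = ⊤
extP P (suc i) = P i

liftD : Binder → Term S → Term S
liftD abst = ren suc
liftD abbr = id

extS : Binder → (ℕ → Term S) → ℕ → Term S
extS abst = exts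
extS abbr = id

shiftS : Binder → ℕ → Term S
shiftS abst = var ∘ suc
shiftS abbr = var

sub-shiftS : ∀ b (t : Term S) → sub (shiftS b) t ≡ liftD b t
sub-shiftS abst t = ren-as-sub t
sub-shiftS abbr t = sub-var t

iter : (S → S) → ℕ → S → S
iter next zero    s = s
iter next (suc n) s = iter next n (next s)

module IteratedTypes {S : Set} (next : S → S) (N : ℕ) where

  ty : (ℕ → Types S) → Term S → Types S
  ty ρ (sort s)        n       = sort (iter next n s)
  ty ρ (var i)         n       = ρ i n
  ty ρ (app V T)       n       = app (ty ρ V 0) (ty ρ T n)
  ty ρ (bind abst W T) n       = lam (chain (ty ρ W) N) (ty (extD abst (ty ρ W) ρ) T n)
  ty ρ (bind abbr V T) n       = ty (extD abbr (ty ρ V) ρ) T n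
  ty ρ (cast U T)      zero    = ty ρ T 0
  ty ρ (cast U T)      (suc n) = ty ρ U n

  ⟦_⟧ : Env S → ℕ → Types S
  ⟦ ∅ ⟧           i n = var i
  ⟦ L , b [ V ] ⟧     = extD b (ty ⟦ L ⟧ V) ⟦ L ⟧

  -- `f` and `g` rename the term while `σ` acts on its values, so one notion serves weakening,
  -- strengthening, change of environment and β. Agreement goes up to `N` because every λ carries
  -- its domain at all these levels.
  SubAgree : (ℕ → Term S) → (ℕ → ℕ) → (ℕ → ℕ) → (ℕ → Types S) → (ℕ → Types S) → Set
  SubAgree σ f g ρ ρ′ = ∀ i n → n ≤ N → sub σ (ρ (f i) n) ≈ ρ′ (g i) n

  subAgree-ext : ∀ {σ ρ ρ′} {w w′ : Types S} b → SubAgree σ f g ρ ρ′ →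
    (∀ n → n ≤ N → sub σ (w n) ≈ w′ n) →
    SubAgree (extS b σ) (ext f) (ext g) (extD b w ρ) (extD b w′ ρ′)
  subAgree-ext abst h e zero    zero    n≤N = ≈-refl
  subAgree-ext {w = w} abst h e zero (suc n) n≤N =
    ≈-trans (≈-reflexive (sub-exts-suc (w n))) (≈-ren (e n (<⇒≤ n≤N)))
  subAgree-ext {f = f} {ρ = ρ} abst h e (suc i) n n≤N =
    ≈-trans (≈-reflexive (sub-exts-suc (ρ (f i) n))) (≈-ren (h i n n≤N))
  subAgree-ext abbr h e zero    n       n≤N = e n n≤N
  subAgree-ext abbr h e (suc i) n       n≤N = h i n n≤N

  ty-natural : ∀ {σ ρ ρ′} → SubAgree σ f g ρ ρ′ → ∀ T n → n ≤ N →
    sub σ (ty ρ (ren f T) n) ≈ ty ρ′ (ren g T) n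
  ty-natural h (sort s)        n n≤N = ≈-refl
  ty-natural h (var i)         n n≤N = h i n n≤N
  ty-natural h (app V T)       n n≤N = ≈-app (ty-natural h V 0 z≤n) (ty-natural h T n n≤N)
  ty-natural {f = f} {ρ = ρ} h (bind abst W T) n n≤N =
    ≈-bind (≈-trans (≈-reflexive (sub-chain (ty ρ (ren f W)) N)) (≈-chain N (ty-natural h W)))
           (ty-natural (subAgree-ext abst h (ty-natural h W)) T n n≤N)
  ty-natural h (bind abbr V T) n n≤N =
    ty-natural (subAgree-ext abbr h (ty-natural h V)) T n n≤N
  ty-natural h (cast U T)      zero    n≤N = ty-natural h T 0 z≤n
  ty-natural h (cast U T)      (suc n) n≤N = ty-natural h U n (<⇒≤ n≤N)

  Agree : (ℕ → Types S) → (ℕ → Types S) → Set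
  Agree = SubAgree var id id

  ty-sub : ∀ {σ ρ ρ′} → SubAgree σ id id ρ ρ′ → ∀ T n → n ≤ N → sub σ (ty ρ T n) ≈ ty ρ′ T n
  ty-sub {σ = σ} {ρ} {ρ′} h T n n≤N =
    subst (λ t → sub σ (ty ρ t n) ≈ ty ρ′ t n) (ren-id T) (ty-natural h T n n≤N)

  ty-cong : ∀ {ρ ρ′} → Agree ρ ρ′ → ∀ T n → n ≤ N → ty ρ T n ≈ ty ρ′ T n
  ty-cong h T n n≤N = ≈-trans (≈-reflexive (sym (sub-var _))) (ty-sub h T n n≤N)

  agree-ext : ∀ {ρ} {w w′ : Types S} b → (∀ n → n ≤ N → w n ≈ w′ n) →
    Agree (extD b w ρ) (extD b w′ ρ)
  agree-ext {ρ = ρ} {w} {w′} b h i n n≤N = ≈-trans (≈-reflexive (sub-var _)) (pointwise b i n n≤N)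
    where
    pointwise : ∀ b i n → n ≤ N → extD b w ρ i n ≈ extD b w′ ρ i n
    pointwise abst zero    zero    _   = ≈-refl
    pointwise abst zero    (suc n) n≤N = ≈-ren (h n (<⇒≤ n≤N))
    pointwise abst (suc i) n       _   = ≈-refl
    pointwise abbr zero    n       n≤N = h n n≤N
    pointwise abbr (suc i) n       _   = ≈-refl

  subAgree-shift : ∀ {ρ} {w : Types S} b → SubAgree (shiftS b) id suc ρ (extD b w ρ)
  subAgree-shift {ρ = ρ} abst i n _ = ≈-reflexive (sub-shiftS abst (ρ i n))
  subAgree-shift {ρ = ρ} abbr i n _ = ≈-reflexive (sub-shiftS abbr (ρ i n))

  ty-↑ : ∀ {ρ} {w : Types S} b T n → n ≤ N → liftD b (ty ρ T n) ≈ ty (extD b w ρ) (↑ T) n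
  ty-↑ {ρ} {w} b T n n≤N rewrite ↑-ren T = ≈-trans
    (≈-reflexive (sym (sub-shiftS b _)))
    (subst (λ t → sub (shiftS b) (ty ρ t n) ≈ ty (extD b w ρ) (ren suc T) n) (ren-id T)
      (ty-natural (subAgree-shift {ρ} {w} b) T n n≤N))

  -- Substituting V for x turns the types of x given by an entry x:W into those given by x=cast(W,V).
  subAgree-β : ∀ {ρ V W} →
    SubAgree (inst (ty ρ V 0)) id id (extD abst (ty ρ W) ρ) (extD abbr (ty ρ (cast W V)) ρ)
  subAgree-β zero    zero    _ = ≈-refl
  subAgree-β zero    (suc n) _ = ≈-reflexive (inst-suc _)
  subAgree-β (suc i) n       _ = ≈-reflexive (inst-suc _)

-- Semantic validity

+-swap : ∀ a b c → a + (b + c) ≡ b + (a + c)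
+-swap a b c = trans (sym (+-assoc a b c)) (trans (cong (_+ c) (+-comm a b)) (+-assoc b a c))

-- The largest level used by an application in the derivation. `A` may be unbounded, but a
-- derivation is finite, so `B` and `N` can be chosen from it.
bound : {next : S → S} {A : Pred ℕ 0ℓ} → ∀ {L T} → Valid next A L T → ℕ
bound v-sort                    = 0
bound (v-zero v)                = bound v
bound (v-suc v)                 = bound v
bound (v-bind v u)              = bound v ⊔ bound u
bound (v-cast v u _ _)          = bound v ⊔ bound u
bound (v-app {n = n} v u _ _ _) = n ⊔ (bound v ⊔ bound u)

module Semantics {S : Set} (next : S → S) (A : Pred ℕ 0ℓ) (N B : ℕ) where

  open IteratedTypes next N

  Applicable : (ℕ → Types S) → Term S → Term S → ℕ → Set
  Applicable ρ V T n = ∃₂ λ w Z →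
    ty ρ T n ≈ lam (chain w N) Z × (∀ j → j < N → w j ≈ ty ρ V (suc j))

  -- m bounds the levels at which T itself is constrained: an n-step of T consumes n of them, whereas
  -- domains, definientia and arguments only undergo 0-steps and are constrained up to level N.
  -- B bounds the levels n ∈ A used by applications and has to stay below m.
  data Ok (m : ℕ) (ρ : ℕ → Types S) (P : ℕ → Set) : Term S → Set where
    o-sort : ∀ {s} → Ok m ρ P (sort s)
    o-var  : ∀ {i} → P i → Ok m ρ P (var i)
    o-bind : ∀ {b V T} → Ok N ρ P V → Ok m (extD b (ty ρ V) ρ) (extP P) T →
             Ok m ρ P (bind b V T)
    o-cast : ∀ {U T} → Ok m ρ P U → Ok m ρ P T →
             (∀ k → k < m → ty ρ T (suc k) ≈ ty ρ U k) → Ok m ρ P (cast U T)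
    o-app  : ∀ {V T n} → Ok N ρ P V → Ok m ρ P T → n ∈ A → n ≤ B →
             (∀ k → n + k ≤ m → Applicable ρ V T (n + k)) → Ok m ρ P (app V T)

  -- Like `v-zero` and `v-suc`, this is a condition on each variable, so only the entries that a
  -- term refers to are constrained.
  Φ : Env S → ℕ → Set
  Φ ∅             i       = ⊥
  Φ (L , b [ V ]) zero    = Ok N ⟦ L ⟧ (Φ L) V
  Φ (L , b [ V ]) (suc i) = Φ L i

  ok-mono : ∀ {m m′ ρ P T} → m′ ≤ m → Ok m ρ P T → Ok m′ ρ P T
  ok-mono le o-sort            = o-sort
  ok-mono le (o-var p)         = o-var p
  ok-mono le (o-bind oV oT)    = o-bind oV (ok-mono le oT)
  ok-mono le (o-cast oU oT c)  =
    o-cast (ok-mono le oU) (ok-mono le oT) (λ k k<m → c k (≤-trans k<m le))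
  ok-mono le (o-app oV oT n∈A n≤B c) =
    o-app oV (ok-mono le oT) n∈A n≤B (λ k n+k≤m → c k (≤-trans n+k≤m le))

  ok-natural : ∀ {m σ ρ ρ′ P P′} → m ≤ N → SubAgree σ f g ρ ρ′ → (∀ i → P (f i) → P′ (g i)) →
    ∀ T → Ok m ρ P (ren f T) → Ok m ρ′ P′ (ren g T)
  ok-natural m≤N h hP (sort s)     o-sort         = o-sort
  ok-natural m≤N h hP (var i)      (o-var p)      = o-var (hP i p)
  ok-natural m≤N h hP (bind b V T) (o-bind oV oT) =
    o-bind (ok-natural ≤-refl h hP V oV)
      (ok-natural m≤N (subAgree-ext b h (ty-natural h V))
        (λ { zero _ → tt ; (suc i) p → hP i p }) T oT)
  ok-natural m≤N h hP (cast U T) (o-cast oU oT c) =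
    o-cast (ok-natural m≤N h hP U oU) (ok-natural m≤N h hP T oT) λ k k<m →
      ≈-trans (≈-sym (ty-natural h T (suc k) (≤-trans k<m m≤N)))
        (≈-trans (≈-sub (c k k<m)) (ty-natural h U k (≤-trans (<⇒≤ k<m) m≤N)))
  ok-natural {σ = σ} m≤N h hP (app V T) (o-app {n = n} oV oT n∈A n≤B c) =
    o-app (ok-natural ≤-refl h hP V oV) (ok-natural m≤N h hP T oT) n∈A n≤B λ k n+k≤m →
      let w , Z , e , d = c k n+k≤m in
      sub σ ∘ w , sub (exts σ) Z ,
      ≈-trans (≈-sym (ty-natural h T (n + k) (≤-trans n+k≤m m≤N)))
        (≈-trans (≈-sub e) (≈-reflexive (cong (λ a → lam a _) (sub-chain w N)))) ,
      λ j j<N → ≈-trans (≈-sub (d j j<N)) (ty-natural h V (suc j) j<N)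

  ok-sub : ∀ {m σ ρ ρ′ P P′ T} → m ≤ N → SubAgree σ id id ρ ρ′ → (∀ i → P i → P′ i) →
    Ok m ρ P T → Ok m ρ′ P′ T
  ok-sub {m} {σ} {ρ} {ρ′} {P} {P′} {T} m≤N h hP o = subst (Ok m ρ′ P′) (ren-id T)
    (ok-natural m≤N h hP T (subst (Ok m ρ P) (sym (ren-id T)) o))

  ok-weaken : ∀ {m ρ P P′ T} → m ≤ N → (∀ i → P i → P′ i) → Ok m ρ P T → Ok m ρ P′ T
  ok-weaken m≤N = ok-sub m≤N (λ i n _ → ≈-reflexive (sub-var _))

  ok-↑ : ∀ {m ρ P P′} b {w : Types S} {T} → m ≤ N → (∀ i → P i → P′ (suc i)) →
    Ok m ρ P T → Ok m (extD b w ρ) P′ (↑ T)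
  ok-↑ {m} {ρ} {P} {P′} b {w} {T} m≤N hP o =
    subst (Ok m _ P′) (sym (↑-ren T))
      (ok-natural m≤N (subAgree-shift {ρ} {w} b) hP T (subst (Ok m ρ P) (sym (ren-id T)) o))

  ok-unshift : ∀ {m ρ P} {w : Types S} {T} → m ≤ N →
    Ok m (extD abbr w ρ) (extP P) (↑ T) → Ok m ρ P T
  ok-unshift {m} {ρ} {P} {w} {T} m≤N o =
    subst (Ok m ρ P) (ren-id T)
      (ok-natural m≤N (λ i n _ → ≈-reflexive (sub-var _)) (λ i p → p) T
        (subst (Ok m (extD abbr w ρ) (extP P)) (↑-ren T) o))

  ok-enter : ∀ {m L V T} → m ≤ N → Ok N ⟦ L ⟧ (Φ L) V →
    Ok m ⟦ L , b [ V ] ⟧ (extP (Φ L)) T → Ok m ⟦ L , b [ V ] ⟧ (Φ (L , b [ V ])) T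
  ok-enter m≤N oV = ok-weaken m≤N (λ { zero _ → oV ; (suc i) p → p })

  ok-leave : ∀ {m L V T} → m ≤ N →
    Ok m ⟦ L , b [ V ] ⟧ (Φ (L , b [ V ])) T → Ok m ⟦ L , b [ V ] ⟧ (extP (Φ L)) T
  ok-leave m≤N = ok-weaken m≤N (λ { zero _ → tt ; (suc i) p → p })

  -- An `n`-step lowers iterated types by `n` levels and uses up `n` levels of `Ok`. Both claims are
  -- proved together, since the new side conditions come from the old ones through the conversions.
  -- `B ≤ m` leaves room for the level at which an application inspects its function.
  preservation : ∀ {L n T X} → Step next L n T X → ∀ {m} → B ≤ m → n + m ≤ N →
    Ok (n + m) ⟦ L ⟧ (Φ L) T →
    Ok m ⟦ L ⟧ (Φ L) X × (∀ k → k ≤ m → ty ⟦ L ⟧ T (n + k) ≈ ty ⟦ L ⟧ X k)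
  preservation {L} (β {V = V} {W} {T}) {m} B≤m m≤N (o-app {n = n} oV (o-bind oW oT) n∈A n≤B c) =
    o-bind (o-cast oW oV typed) (ok-sub m≤N subAgree-β (λ i p → p) oT) ,
    λ k k≤m → ≈-trans ≈-β (ty-sub subAgree-β T k (≤-trans k≤m m≤N))
    where
    typed : ∀ j → j < N → ty ⟦ L ⟧ V (suc j) ≈ ty ⟦ L ⟧ W j
    typed j j<N =
      -- The function is the λ itself, with the same annotation at every level. At `k = 0`, allowed
      -- by `n ≤ B ≤ m`, injectivity of tuples equates the types of `W` with those of `V` one level
      -- up: the condition of the new cast.
      let w , Z , e , d = c 0 (subst (_≤ m) (sym (+-identityʳ n)) (≤-trans n≤B B≤m))
      in ≈-sym (≈-trans (chain-inj N (bind-injˡ e) j (m≤n⇒m≤1+n j<N)) (d j j<N))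
  preservation (δ {V = V}) B≤m m≤N (o-var oV) =
    ok-↑ abbr m≤N (λ i p → p) (ok-mono m≤N oV) ,
    λ k k≤m → ty-↑ abbr V k (≤-trans k≤m m≤N)
  preservation (ζ {T = T}) B≤m m≤N (o-bind oV oT) =
    ok-unshift m≤N oT ,
    λ k k≤m → ≈-sym (ty-↑ abbr T k (≤-trans k≤m m≤N))
  preservation (θ {V = V}) B≤m m≤N (o-app oV (o-bind oW oT) n∈A n≤B c) =
    o-bind oW (o-app (ok-↑ abbr ≤-refl (λ i p → p) oV) oT n∈A n≤B
      λ k n+k≤m → let w , Z , e , d = c k n+k≤m in
        w , Z , e , λ j j<N → ≈-trans (d j j<N) (ty-↑ abbr V (suc j) j<N)) ,
    λ k k≤m → ≈-app (ty-↑ abbr V 0 z≤n) ≈-refl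
  preservation ε B≤m m≤N (o-cast oU oT c) =
    oT , λ { zero _ → ≈-refl ; (suc k) k<m → ≈-sym (c k k<m) }
  preservation srt B≤m m<N o-sort = o-sort , λ k _ → ≈-refl
  preservation (ldec {W = W}) B≤m m<N (o-var oW) =
    ok-↑ abst (<⇒≤ m<N) (λ i p → p) (ok-mono (<⇒≤ m<N) oW) ,
    λ k k≤m → ty-↑ abst W k (≤-trans k≤m (<⇒≤ m<N))
  preservation ee B≤m m<N (o-cast oU oT c) =
    ok-mono (n≤1+n _) oU , λ k _ → ≈-refl
  preservation {n = n} (lref {K} {b} {V} {i} {T = T} s) {m} B≤m n+m≤N (o-var p) =
    let oT , e = preservation s B≤m n+m≤N (o-var p)
        m≤N = m+n≤o⇒n≤o n n+m≤N
    in ok-↑ b m≤N (λ i p → p) oT ,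
       λ k k≤m → ≈-trans (var-suc b (e k k≤m)) (ty-↑ b T k (≤-trans k≤m m≤N))
    where
    var-suc : ∀ b {k t} → ⟦ K ⟧ i k ≈ t → ⟦ K , b [ V ] ⟧ (suc i) k ≈ liftD b t
    var-suc abst e = ≈-ren e
    var-suc abbr e = e
  preservation (appV s) B≤m m≤N (o-app oV oT n∈A n≤B c) =
    -- Arguments are `Ok` up to `N`, so the induction hypothesis is taken at `m = N` and covers
    -- every level in `Applicable`.
    let oV′ , e = preservation s (≤-trans B≤m m≤N) ≤-refl oV in
    o-app oV′ oT n∈A n≤B
      (λ k n+k≤m → let w , Z , e′ , d = c k n+k≤m in
        w , Z , e′ , λ j j<N → ≈-trans (d j j<N) (e (suc j) j<N)) ,
    λ k _ → ≈-app (e 0 z≤n) ≈-refl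
  preservation {L} {n} (appT {V = V} {T₁ = T₁} {T₂} s) {m} B≤m n+m≤N (o-app {n = a} oV oT a∈A a≤B c) =
    let oT′ , e = preservation s B≤m n+m≤N oT in
    o-app oV oT′ a∈A a≤B
      (λ k a+k≤m →
        -- The condition on `T₂` at `a + k` is that on `T₁` at `a + (n + k)`: demanding all higher
        -- levels is what makes it survive the step.
        let w , Z , e′ , d = subst (Applicable ⟦ L ⟧ V T₁) (+-swap a n k)
              (c (n + k) (subst (_≤ n + m) (+-swap n a k) (+-monoʳ-≤ n a+k≤m)))
        in w , Z , ≈-trans (≈-sym (e (a + k) a+k≤m)) e′ , d) ,
    λ k k≤m → ≈-app ≈-refl (e k k≤m)
  preservation {L} (bndV {b = b} {V₁} {V₂} {T} s) {m} B≤m m≤N (o-bind oV oT) =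
    let oV′ , e = preservation s (≤-trans B≤m m≤N) ≤-refl oV in
    o-bind oV′ (ok-sub m≤N (agree-ext b e) (λ i p → p) oT) ,
    λ k k≤m → bind-cong b e k (≤-trans k≤m m≤N)
    where
    bind-cong : ∀ b → (∀ k → k ≤ N → ty ⟦ L ⟧ V₁ k ≈ ty ⟦ L ⟧ V₂ k) →
      ∀ k → k ≤ N → ty ⟦ L ⟧ (bind b V₁ T) k ≈ ty ⟦ L ⟧ (bind b V₂ T) k
    bind-cong abst e k k≤N = ≈-bind (≈-chain N e) (ty-cong (agree-ext abst e) T k k≤N)
    bind-cong abbr e k k≤N = ty-cong (agree-ext abbr e) T k k≤N
  preservation {L} {n} (bndT {b = b} {V} {T₁ = T₁} {T₂} s) {m} B≤m n+m≤N (o-bind oV oT) =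
    let oT′ , e = preservation s B≤m n+m≤N (ok-enter n+m≤N oV oT) in
    o-bind oV (ok-leave (m+n≤o⇒n≤o n n+m≤N) oT′) ,
    λ k k≤m → bind-cong b (e k k≤m)
    where
    bind-cong : ∀ b {k l} → ty ⟦ L , b [ V ] ⟧ T₁ k ≈ ty ⟦ L , b [ V ] ⟧ T₂ l →
      ty ⟦ L ⟧ (bind b V T₁) k ≈ ty ⟦ L ⟧ (bind b V T₂) l
    bind-cong abst e = ≈-bind ≈-refl e
    bind-cong abbr e = e
  preservation (cstU s) B≤m m≤N (o-cast oU oT c) =
    let oU′ , e = preservation s B≤m m≤N oU in
    o-cast oU′ oT (λ k k<m → ≈-trans (c k k<m) (e k (<⇒≤ k<m))) ,
    λ { zero _ → ≈-refl ; (suc k) k<m → e k (<⇒≤ k<m) }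
  preservation (cstT s) B≤m m≤N (o-cast oU oT c) =
    let oT′ , e = preservation s B≤m m≤N oT in
    o-cast oU oT′ (λ k k<m → ≈-trans (≈-sym (e (suc k) k<m)) (c k k<m)) ,
    λ { zero k≤m → e 0 z≤n ; (suc k) _ → ≈-refl }
  preservation (cst1 s r) B≤m m<N (o-cast oU oT c) =
    let oU′ , e = preservation s B≤m m<N oU
        oT′ , d = preservation r B≤m m<N oT in
    o-cast oU′ oT′
      (λ k k<m → ≈-trans (≈-sym (d (suc k) k<m)) (≈-trans (c (suc k) (s≤s k<m)) (e k (<⇒≤ k<m)))) ,
    -- Level 1 of the old cast lies on the `U` side, level 0 of the new one on the `T` side; the old
    -- side condition at 0 links them.
    λ { zero _      → ≈-trans (≈-sym (c 0 (s≤s z≤n))) (d 0 z≤n)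
      ; (suc k) k<m → e k (<⇒≤ k<m) }

  preservation* : ∀ {L n T X} → Steps next L n T X → ∀ {m} → B ≤ m → n + m ≤ N →
    Ok (n + m) ⟦ L ⟧ (Φ L) T →
    Ok m ⟦ L ⟧ (Φ L) X × (∀ k → k ≤ m → ty ⟦ L ⟧ T (n + k) ≈ ty ⟦ L ⟧ X k)
  preservation* s-refl     B≤m n+m≤N o = o , λ _ _ → ≈-refl
  preservation* (s-step s) B≤m n+m≤N o = preservation s B≤m n+m≤N o
  preservation* {L} (s-trans {n₁ = n₁} {n₂} {T₁} {T} r s) {m} B≤m n+m≤N o =
    let le = subst (_≤ N) (+-assoc n₁ n₂ m) n+m≤N
        o₁ , e = preservation* r (≤-trans B≤m (m≤n+m m n₂)) le
                   (subst (λ l → Ok l ⟦ L ⟧ (Φ L) T₁) (+-assoc n₁ n₂ m) o)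
        o₂ , d = preservation* s B≤m (m+n≤o⇒n≤o n₁ le) o₁
    in o₂ , λ k k≤m →
       ≈-trans (subst (λ l → ty ⟦ L ⟧ T₁ l ≈ ty ⟦ L ⟧ T (n₂ + k)) (sym (+-assoc n₁ n₂ k)) (e (n₂ + k) (+-monoʳ-≤ n₂ k≤m)))
               (d k k≤m)

  -- Reduction to the iterated types, and the return to validity.

  Realizes : Env S → (ℕ → ℕ) → (ℕ → Types S) → (ℕ → Set) → Set
  Realizes L r ρ P = ∀ i → P i → ∀ n → Steps next L n (var i) (ren r (strip (ρ i n)))

  -- A definition is unfolded in the iterated types, which therefore skip its index.
  extR : Binder → (ℕ → ℕ) → ℕ → ℕ
  extR abst r = ext r
  extR abbr r = suc ∘ r

  realizes-zero : ∀ {L r ρ V} {w : Types S} b → (∀ n → Steps next L n V (ren r (strip (w n)))) →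
    ∀ n → Steps next (L , b [ V ]) n (var 0) (ren (extR b r) (strip (extD b w ρ 0 n)))
  realizes-zero abst e zero = s-refl
  realizes-zero {r = r} {w = w} abst e (suc n) =
    subst (Steps next _ _ _)
      (sym (trans (cong (ren (ext r)) (strip-ren (w n))) (ren-ext-suc (strip (w n)))))
      (steps-ldec (e n))
  realizes-zero {w = w} abbr e n =
    subst (Steps next _ _ _) (ren-ren (strip (w n))) (steps-δ (e n))

  realizes-suc : ∀ {L r ρ V i} {w : Types S} b → (∀ n → Steps next L n (var i) (ren r (strip (ρ i n)))) →
    ∀ n → Steps next (L , b [ V ]) n (var (suc i)) (ren (extR b r) (strip (extD b w ρ (suc i) n)))
  realizes-suc {r = r} {ρ} {i = i} abst e n =
    subst (Steps next _ _ _)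
      (sym (trans (cong (ren (ext r)) (strip-ren (ρ i n))) (ren-ext-suc (strip (ρ i n)))))
      (steps-weaken (e n))
  realizes-suc {ρ = ρ} {i = i} abbr e n =
    subst (Steps next _ _ _) (ren-ren (strip (ρ i n))) (steps-weaken (e n))

  realizes-ext : ∀ {L r ρ P V} {w : Types S} b → Realizes L r ρ P →
    (∀ n → Steps next L n V (ren r (strip (w n)))) →
    Realizes (L , b [ V ]) (extR b r) (extD b w ρ) (extP P)
  realizes-ext {ρ = ρ} b h e zero _ = realizes-zero {ρ = ρ} b e
  realizes-ext {ρ = ρ} b h e (suc i) p = realizes-suc {ρ = ρ} b (h i p)

  steps-sort : ∀ {L} n {s} → Steps next L n (sort s) (sort (iter next n s))
  steps-sort zero    = s-refl
  steps-sort (suc n) = s-trans (s-step srt) (steps-sort n)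

  -- Each clause of `ty` is matched by reductions: `ε` or `ee` at a cast, congruence at an
  -- application or a λ, unfolding and then `ζ` at a definition. The domain of a λ takes 0-steps
  -- only, to the component that `strip` keeps.
  steps-ty : ∀ {L r m ρ P T} → Realizes L r ρ P → Ok m ρ P T →
    ∀ n → Steps next L n T (ren r (strip (ty ρ T n)))
  steps-ty h o-sort n              = steps-sort n
  steps-ty h (o-var p) n           = h _ p n
  steps-ty {r = r} {ρ = ρ} h (o-bind {abst} {V} oV oT) n =
    steps-bind
      (subst (λ t → Steps next _ 0 V (ren r t)) (sym (strip-chain (ty ρ V) N)) (steps-ty h oV 0))
      (steps-ty (realizes-ext abst h (steps-ty h oV)) oT n)
  steps-ty {ρ = ρ} h (o-bind {abbr} {V} {T} oV oT) n =
    steps-ζ (subst (Steps next _ n T) (sym (ren-ren (strip (ty (extD abbr (ty ρ V) ρ) T n))))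
      (steps-ty (realizes-ext abbr h (steps-ty h oV)) oT n))
  steps-ty h (o-cast oU oT c) zero    = s-trans (s-step ε) (steps-ty h oT 0)
  steps-ty h (o-cast oU oT c) (suc n) = s-trans (s-step ee) (steps-ty h oU n)
  steps-ty h (o-app oV oT n∈A n≤B c) n = steps-app (steps-ty h oV 0) (steps-ty h oT n)

  steps-ren : ∀ {L t u} r → t ⇒* u → Steps next L 0 (ren r t) (ren r u)
  steps-ren r p = par*⇒steps (gmap (ren r) p-ren p)

  steps-snoc : ∀ {L n T X Y} → Steps next L n T X → Steps next L 0 X Y → Steps next L n T Y
  steps-snoc {n = n} r s = subst (λ k → Steps next _ k _ _) (+-identityʳ n) (s-trans r s)

  -- Side conditions are read at their lowest level. The two stripped types have a common reduct,
  -- and `steps-ty` leads to it from both sides; this is the witness for `v-cast` and `v-app`. The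
  -- strict bounds ensure that `m` and `N` are positive.
  ok⇒valid : ∀ {L r m ρ P T} → B < N → B < m → Realizes L r ρ P →
    (∀ i → P i → Valid next A L (var i)) → Ok m ρ P T → Valid next A L T
  ok⇒valid B<N B<m h v o-sort         = v-sort
  ok⇒valid B<N B<m h v (o-var p)      = v _ p
  ok⇒valid B<N B<m h v (o-bind {b} {V} oV oT) =
    let vV = ok⇒valid B<N B<N h v oV in
    v-bind vV (ok⇒valid B<N B<m (realizes-ext b h (steps-ty h oV))
      (λ { zero _ → v-zero vV ; (suc i) p → v-suc (v i p) }) oT)
  ok⇒valid {r = r} B<N B<m h v (o-cast oU oT c) =
    let _ , p , q = ≈-map strip p-strip (c 0 (≤-trans (s≤s z≤n) B<m)) in
    v-cast (ok⇒valid B<N B<m h v oU) (ok⇒valid B<N B<m h v oT)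
      (steps-snoc (steps-ty h oT 1) (steps-ren r p))
      (steps-snoc (steps-ty h oU 0) (steps-ren r q))
  ok⇒valid {r = r} {m} {ρ} B<N B<m h v (o-app {V} {T} {n} oV oT n∈A n≤B c)
    with subst (Applicable ρ V T) (+-identityʳ n)
           (c 0 (subst (_≤ m) (sym (+-identityʳ n)) (≤-trans n≤B (<⇒≤ B<m))))
  ... | w , Z , e , d with lam-type
    where
    lam-type : strip (ty ρ T n) ≈ lam (strip (ty ρ V 1)) (strip Z)
    lam-type = ≈-trans (≈-map strip p-strip e)
      (≈-bind (≈-trans (≈-reflexive (strip-chain w N))
                       (≈-map strip p-strip (d 0 (≤-trans (s≤s z≤n) B<N)))) ≈-refl)
  -- The common reduct is a λ, and its domain is a reduct of the stripped type of `V` at level 1.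
  ... | _ , p , q with bind-⇒* q
  ... | _ , _ , refl , q₁ , _ =
    v-app (ok⇒valid B<N B<N h v oV) (ok⇒valid B<N B<m h v oT) n∈A
      (steps-snoc (steps-ty h oT n) (steps-ren r p))
      (steps-snoc (steps-ty h oV 1) (steps-ren r q₁))

  envRen : Env S → ℕ → ℕ
  envRen ∅             = id
  envRen (L , b [ V ]) = extR b (envRen L)

  realizes-env : ∀ L → Realizes L (envRen L) ⟦ L ⟧ (Φ L)
  realizes-env (L , b [ V ]) zero    oV =
    realizes-zero {ρ = ⟦ L ⟧} b (steps-ty (realizes-env L) oV)
  realizes-env (L , b [ V ]) (suc i) p  =
    realizes-suc {ρ = ⟦ L ⟧} b (realizes-env L i p)

  Φ⇒valid : B < N → ∀ L i → Φ L i → Valid next A L (var i)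
  Φ⇒valid B<N (L , b [ V ]) zero    oV =
    v-zero (ok⇒valid B<N B<N (realizes-env L) (Φ⇒valid B<N L) oV)
  Φ⇒valid B<N (L , b [ V ]) (suc i) p  = v-suc (Φ⇒valid B<N L i p)

  -- By `preservation*`, a reduction in a validity rule becomes a conversion at all remaining
  -- levels, once the reducing subterm is known to be `Ok`. Joining two such conversions gives the
  -- side condition.
  valid⇒ok : B + B < N → ∀ {L T} (v : Valid next A L T) → bound v ≤ B → Ok N ⟦ L ⟧ (Φ L) T
  valid⇒ok B+B<N = go
    where
    B<N : B < N
    B<N = ≤-trans (s≤s (m≤m+n B B)) B+B<N

    -- `suc B` covers the levels `n ≤ B` of applications as well as level 1, even for `B = 0`. When
    -- `n` levels are spent, `B` must remain, whence `B + B < N`.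
    typeConversion : ∀ {L T X n} → n ≤ suc B → Ok N ⟦ L ⟧ (Φ L) T → Steps next L n T X →
      ∀ k → n + k ≤ N → ty ⟦ L ⟧ T (n + k) ≈ ty ⟦ L ⟧ X k
    typeConversion {L} {T} {n = n} n≤1+B o s k n+k≤N =
      proj₂ (preservation* s B≤N∸n (≤-reflexive n+N∸n≡N)
               (subst (λ l → Ok l ⟦ L ⟧ (Φ L) T) (sym n+N∸n≡N) o))
        k (m+n≤o⇒m≤o∸n k (subst (_≤ N) (+-comm n k) n+k≤N))
      where
      n+N∸n≡N : n + (N ∸ n) ≡ N
      n+N∸n≡N = m+[n∸m]≡n (≤-trans n≤1+B B<N)
      B≤N∸n : B ≤ N ∸ n
      B≤N∸n = m+n≤o⇒m≤o∸n B
        (≤-trans (+-monoʳ-≤ B n≤1+B) (subst (_≤ N) (sym (+-suc B B)) B+B<N))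

    go : ∀ {L T} (v : Valid next A L T) → bound v ≤ B → Ok N ⟦ L ⟧ (Φ L) T
    go v-sort       _  = o-sort
    go (v-zero v)   le = o-var (go v le)
    go (v-suc v)    le with go v le
    ... | o-var p      = o-var p
    go (v-bind v u) le =
      o-bind (go v (m⊔n≤o⇒m≤o (bound v) _ le)) (ok-leave ≤-refl (go u (m⊔n≤o⇒n≤o (bound v) _ le)))
    go (v-cast v u s r) le =
      let oU = go v (m⊔n≤o⇒m≤o (bound v) _ le)
          oT = go u (m⊔n≤o⇒n≤o (bound v) _ le)
      in o-cast oU oT λ k k<N →
        ≈-trans (typeConversion (s≤s z≤n) oT s k k<N)
                (≈-sym (typeConversion z≤n oU r k (<⇒≤ k<N)))
    go {L} (v-app {V = V} {T} {n} {W₀} {U₀} v u n∈A s r) le =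
      let n≤B = m⊔n≤o⇒m≤o n _ le
          le′ = m⊔n≤o⇒n≤o n _ le
          oV  = go v (m⊔n≤o⇒m≤o (bound v) _ le′)
          oT  = go u (m⊔n≤o⇒n≤o (bound v) _ le′)
      in o-app oV oT n∈A n≤B λ k n+k≤N →
        ty ⟦ L ⟧ W₀ , ty (extD abst (ty ⟦ L ⟧ W₀) ⟦ L ⟧) U₀ k ,
        typeConversion (m≤n⇒m≤1+n n≤B) oT s k n+k≤N ,
        λ j j<N → ≈-sym (typeConversion (s≤s z≤n) oV r j j<N)

theorem5p4 : (S : Set) → DecidableEquality S → S → (next : S → S) →
    (A : Pred ℕ 0ℓ) (L : Env S) (T₁ T₂ U : Term S) →
    Typed next A L T₁ U → Steps next L 0 T₁ T₂ → Typed next A L T₂ U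
theorem5p4 S _ _ next A L T₁ T₂ U v s =
  -- The reduction runs inside `cast U T₁` at level 0, so `Ok` is kept at `N` throughout.
  ok⇒valid B<N B<N (realizes-env L) (Φ⇒valid B<N L)
    (proj₁ (preservation* (steps₀-map (cast U) cstT refl s) (<⇒≤ B<N) ≤-refl
              (valid⇒ok ≤-refl v ≤-refl)))
  where
  B N : ℕ
  B = bound v
  -- The least value with `B + B < N`.
  N = suc (B + B)

  B<N : B < N
  B<N = s≤s (m≤m+n B B)

  open Semantics next A N B
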